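{- Let $f:\mathbb{N}\to\mathbb{N}$ be a non decreasing function. The following conditions are equivalent: (1) Every lattice $\mathcal{L}$ of regular subsets of $\mathbb{N}$ which is closed under decrement (i.e. $L\cap L'$, $L\cup L'$ and $L-1$ are in $\mathcal{L}$ whenever $L,L'\in\mathcal{L}$) is also closed under $f^{ -1}$ (i.e. $L\in\mathcal{L}$ implies $f^{ -1}(L)\in\mathcal{L}$). (2) The function $f$ satisfies the following properties: (i) $f(a)\geq a$ for all $a\in\mathbb{N}$; (ii) $f(a)-f(b)\equiv 0\pmod{(a-b)}$ for all $a,b\in\mathbb{N}$. Moreover, for every integer $n\geq 1$, the functions $x\mapsto nx$ and $x\mapsto x^n$ (for which $L\mapsto f^{ -1}(L)$ is respectively the $n$-quotient $L\mapsto\{x\in\mathbb{N}\mid nx\in L\}$ and the $n$-root $L\mapsto\{x\in\mathbb{N}\mid x^n\in L\}$) are particular examples of such functions $f$.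
   Context: $\mathbb{N}=\{0,1,2,\ldots\}$. A function $f:\mathbb{N}\to\mathbb{N}$ is non decreasing if $a\leq b$ implies $f(a)\leq f(b)$. A lattice over a set $X$ is any non empty family of subsets of $X$ closed under (binary) union and intersection. For $L\subseteq\mathbb{N}$ and $i\in\mathbb{N}$, $L-i=\{x\in\mathbb{N}\mid x+i\in L\}$. A subset of $\mathbb{N}$ is regular if it is recognized by a finite automaton in unary notation; equivalently, if it is the union of a finite set with finitely many arithmetic progressions $a+r\mathbb{N}$ ($a,r\in\mathbb{N}$, $r\geq1$). $f^{ -1}(L)=\{x\in\mathbb{N}\mid f(x)\in L\}$. Congruences are between integers. -}

module Defs where

open import Data.Fin.Base using (Fin)
import Data.Fin.Subset as Subset
open import Data.Integer.Base as ℤ using (ℤ; +_)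
import Data.Integer.Divisibility.Signed as ℤ
open import Data.List.Base using (List; foldl; replicate)
open import Data.Nat.Base using (ℕ; _+_; _*_; _^_; _≤_; _≥_)
open import Data.Product.Base using (_×_; ∃)
open import Data.Unit.Base using (⊤; tt)
open import Level using (Level; 0ℓ; suc; _⊔_)
open import Relation.Binary.Definitions using (Monotonic₁)
open import Relation.Unary using (Pred; _∈_; _∪_; _∩_; _≐_; _⊢_)

private
  variable
    ℓ : Level
    X : Set

Family : Set → (ℓ : Level) → Set (suc 0ℓ ⊔ suc ℓ)
Family X ℓ = Pred (Pred X 0ℓ) ℓ

-- Subsets are predicates, and two predicates with the same elements are the
-- same subset; a family of subsets must therefore respect _≐_.
record IsLattice (𝓛 : Family X ℓ) : Set (suc 0ℓ ⊔ ℓ) where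
  field
    resp-≐   : ∀ L L′ → L ≐ L′ → L ∈ 𝓛 → L′ ∈ 𝓛
    nonEmpty : ∃ λ L → L ∈ 𝓛
    ∪-closed : ∀ L L′ → L ∈ 𝓛 → L′ ∈ 𝓛 → L ∪ L′ ∈ 𝓛
    ∩-closed : ∀ L L′ → L ∈ 𝓛 → L′ ∈ 𝓛 → L ∩ L′ ∈ 𝓛

record FiniteAutomaton (A : Set) : Set where
  field
    states    : ℕ
    initial   : Fin states
    step      : Fin states → A → Fin states
    accepting : Subset.Subset states

  Language : Pred (List A) 0ℓ
  Language w = foldl step initial w Subset.∈ accepting

open FiniteAutomaton public using (Language)

unary : ℕ → List ⊤
unary x = replicate x tt

Regular : Pred (Pred ℕ 0ℓ) 0ℓ
Regular L = ∃ λ (M : FiniteAutomaton ⊤) → L ≐ (unary ⊢ Language M)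

decrement : ℕ → Pred ℕ 0ℓ → Pred ℕ 0ℓ
decrement i L = λ x → x + i ∈ L

NonDecreasing : (ℕ → ℕ) → Set
NonDecreasing f = Monotonic₁ _≤_ _≤_ f

-- f ⊢ L is the preimage f⁻¹(L).
LatticeCondition : (ℓ : Level) → (ℕ → ℕ) → Set (suc 0ℓ ⊔ suc ℓ)
LatticeCondition ℓ f =
  (𝓛 : Family ℕ ℓ) → IsLattice 𝓛 →
  (∀ L → L ∈ 𝓛 → Regular L) →
  (∀ L → L ∈ 𝓛 → decrement 1 L ∈ 𝓛) →
  ∀ L → L ∈ 𝓛 → (f ⊢ L) ∈ 𝓛

infix 4 _≡_[mod_]

-- With modulus 0 this is equality.
_≡_[mod_] : ℤ → ℤ → ℤ → Set
x ≡ y [mod m ] = m ℤ.∣ (x ℤ.- y)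

ArithmeticCondition : (ℕ → ℕ) → Set
ArithmeticCondition f =
  (∀ a → f a ≥ a) ×
  (∀ a b → (+ f a ℤ.- + f b) ≡ + 0 [mod (+ a ℤ.- + b) ])

quotient : ℕ → Pred ℕ 0ℓ → Pred ℕ 0ℓ
quotient n L = λ x → n * x ∈ L

root : ℕ → Pred ℕ 0ℓ → Pred ℕ 0ℓ
root n L = λ x → x ^ n ∈ L

IsExample : (ℓ : Level) → (ℕ → ℕ) → Set (suc 0ℓ ⊔ suc ℓ)
IsExample ℓ f = NonDecreasing f × LatticeCondition ℓ f × ArithmeticCondition f

{-# OPTIONS --safe #-}
-- Write ⟨a⟩ for the intersection of all the L − i that contain a.  Finitely
-- many of the sets L − i and ⟨a⟩ are distinct when L is regular.
--
-- (2) ⇒ (1): f⁻¹(L) is the union of the ⟨a⟩ with f(a) ∈ L.  Indeed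
-- f(a) = a + i and f(b) = f(a) + k (b − a) with i, k ≥ 0, so if b lies in ⟨a⟩
-- then repeatedly replacing a + j ∈ L by b + j ∈ L leads from f(a) to f(b).
-- The union may be over no a at all, so the intersection of every L − i,
-- which is contained in f⁻¹(L) because f(b) ≥ b, is added to it.
--
-- (1) ⇒ (2): apply the condition to the lattice of all decidable subsets of
-- {0, …, f(a)}, then to that of all decidable d-periodic sets.
module Submission where

open import Defs
open import Data.Bool.Base using (Bool)
open import Data.Fin.Base using (Fin; toℕ; fromℕ<)
open import Data.Fin.Properties using (pigeonhole; toℕ-fromℕ<)
import Data.Fin.Subset as Subset
import Data.Fin.Subset.Properties as Subset
open import Data.Integer.Base as ℤ using (+_)
import Data.Integer.Divisibility.Signed as ℤ
import Data.Integer.Properties as ℤ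
import Data.Integer.Tactic.RingSolver as ℤ
open import Data.List.Base using (foldl)
open import Data.Nat.Base
open import Data.Nat.DivMod
open import Data.Nat.Properties
open import Data.Nat.Tactic.RingSolver using (solve-∀)
open import Data.Product.Base as Product using (_×_; _,_; proj₁; proj₂; ∃; ∃₂)
open import Data.Sum.Base as Sum using (inj₁; inj₂; [_,_]′)
open import Data.Unit.Base using (⊤; tt)
open import Data.Vec.Base using (tabulate)
open import Data.Vec.Properties using (lookup∘tabulate; []=⇒lookup; lookup⇒[]=)
open import Function.Base using (id; _∘_)
open import Function.Bundles using (_⇔_; mk⇔; Equivalence)
import Function.Properties.Equivalence as ⇔
open import Level using (Level; 0ℓ; Lift; lift; lower)
open import Relation.Binary.PropositionalEquality
open import Relation.Nullary.Decidable.Core using (yes; no; does; map′)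
open import Relation.Nullary.Decidable using (dec-true)
open import Relation.Nullary.Negation using (contradiction)
open import Relation.Unary using (Pred; Decidable; _∈_; _∪_; _≐_; _⊢_)
open import Relation.Unary.Properties using (_∪?_; _∩?_)

open Equivalence using (to; from)

private
  variable
    ℓ : Level
    L : Pred ℕ 0ℓ
    f : ℕ → ℕ

-- Integral difference ratios over ℕ

-- Condition (ii) without integers. As `k` is natural, it also forces `f` to be non decreasing.
HasIntegralSlopes : (ℕ → ℕ) → Set
HasIntegralSlopes f = ∀ a d → ∃ λ k → f (a + d) ≡ f a + k * d

[m+n]-m≡n : ∀ m n → + (m + n) ℤ.- + m ≡ + n
[m+n]-m≡n m n = trans (cong (ℤ._- + m) (ℤ.pos-+ m n)) (cancel (+ m) (+ n))
  where
  cancel : ∀ i j → i ℤ.+ j ℤ.- i ≡ j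
  cancel = ℤ.solve-∀

integralSlopes⇒congruence : HasIntegralSlopes f →
  ∀ a b → (+ f a ℤ.- + f b) ≡ + 0 [mod (+ a ℤ.- + b) ]
integralSlopes⇒congruence {f} slopes a b with ≤-total b a
... | inj₁ b≤a = ascending a b b≤a
  where
  ascending : ∀ a b → b ≤ a → (+ f a ℤ.- + f b) ≡ + 0 [mod (+ a ℤ.- + b) ]
  ascending a b b≤a with d , refl ← m≤n⇒∃[o]m+o≡n b≤a
                    with k , eq ← slopes b d
    rewrite eq | [m+n]-m≡n b d | [m+n]-m≡n (f b) (k * d)
    = ℤ.divides (+ k) (trans (ℤ.+-identityʳ _) (ℤ.pos-* k d))
... | inj₂ a≤b with d , refl ← m≤n⇒∃[o]m+o≡n a≤b
               with k , eq ← slopes a d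
    = ℤ.divides (+ k) (begin
        + f a ℤ.- + f (a + d) ℤ.- + 0         ≡⟨ swap (+ f a) (+ f (a + d)) ⟩
        ℤ.- (+ f (a + d) ℤ.- + f a)           ≡⟨ cong (λ y → ℤ.- (+ y ℤ.- + f a)) eq ⟩
        ℤ.- (+ (f a + k * d) ℤ.- + f a)       ≡⟨ cong ℤ.-_ ([m+n]-m≡n (f a) (k * d)) ⟩
        ℤ.- + (k * d)                         ≡⟨ cong ℤ.-_ (ℤ.pos-* k d) ⟩
        ℤ.- (+ k ℤ.* + d)                     ≡⟨ cong (λ y → ℤ.- (+ k ℤ.* y)) ([m+n]-m≡n a d) ⟨
        ℤ.- (+ k ℤ.* (+ (a + d) ℤ.- + a))     ≡⟨ swap* (+ k) (+ (a + d)) (+ a) ⟩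
        + k ℤ.* (+ a ℤ.- + (a + d))           ∎)
  where
  open ≡-Reasoning
  swap : ∀ i j → i ℤ.- j ℤ.- + 0 ≡ ℤ.- (j ℤ.- i)
  swap = ℤ.solve-∀
  swap* : ∀ i j l → ℤ.- (i ℤ.* (j ℤ.- l)) ≡ i ℤ.* (l ℤ.- j)
  swap* = ℤ.solve-∀

congruence⇒integralSlopes : NonDecreasing f →
  (∀ a b → (+ f a ℤ.- + f b) ≡ + 0 [mod (+ a ℤ.- + b) ]) →
  HasIntegralSlopes f
congruence⇒integralSlopes {f} mono congr a d
  with e , fa+e≡f[a+d] ← m≤n⇒∃[o]m+o≡n (mono (m≤m+n a d))
  with ℤ.divides q eq ← congr (a + d) a
  rewrite sym fa+e≡f[a+d] | [m+n]-m≡n a d | [m+n]-m≡n (f a) e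
  -- The quotient `q` may be negative when `d` is 0. Both `e` and `d` are natural, so absolute
  -- values turn `e = q d` into a natural slope.
  = ℤ.∣ q ∣ , cong (λ y → f a + y) (begin
      e                         ≡⟨ cong ℤ.∣_∣ (ℤ.+-identityʳ (+ e)) ⟨
      ℤ.∣ + e ℤ.+ + 0 ∣         ≡⟨ cong ℤ.∣_∣ eq ⟩
      ℤ.∣ q ℤ.* + d ∣           ≡⟨ ℤ.abs-* q (+ d) ⟩
      ℤ.∣ q ∣ * d               ∎)
  where open ≡-Reasoning

%≡%⇒∃k : ∀ m n d .{{_ : NonZero d}} → m ≤ n → n % d ≡ m % d → ∃ λ k → n ≡ m + k * d
%≡%⇒∃k m n d m≤n n%d≡m%d with k , eq ← m≤n⇒∃[o]m+o≡n (/-monoˡ-≤ d m≤n) = k , (begin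
  n                               ≡⟨ m≡m%n+[m/n]*n n d ⟩
  n % d + n / d * d               ≡⟨ cong₂ (λ r s → r + s * d) n%d≡m%d (sym eq) ⟩
  m % d + (m / d + k) * d         ≡⟨ regroup (m % d) (m / d) k d ⟩
  m % d + m / d * d + k * d       ≡⟨ cong (_+ k * d) (m≡m%n+[m/n]*n m d) ⟨
  m + k * d                       ∎)
  where
  open ≡-Reasoning
  regroup : ∀ r s k d → r + (s + k) * d ≡ r + s * d + k * d
  regroup = solve-∀

*-integralSlopes : ∀ n → HasIntegralSlopes (n *_)
*-integralSlopes n a d = n , *-distribˡ-+ n a d

^-integralSlopes : ∀ n → HasIntegralSlopes (_^ n)
^-integralSlopes zero    a d = 0 , refl
^-integralSlopes (suc n) a d with k , eq ← ^-integralSlopes n a d =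
  -- The cofactor of `d` in `(a + d) (a ^ n + k d)` once `a * a ^ n` is removed.
  a * k + a ^ n + k * d , trans (cong ((a + d) *_) eq) (expand a d (a ^ n) k)
  where
  expand : ∀ a d x k → (a + d) * (x + k * d) ≡ a * x + (a * k + x + k * d) * d
  expand = solve-∀

-- Ultimately periodic sets

record UltimatelyPeriodic (L : Pred ℕ 0ℓ) : Set where
  field
    preperiod period : ℕ
    {{period≢0}}     : NonZero period
    shift            : ∀ x → preperiod ≤ x → x ∈ L ⇔ x + period ∈ L

  shift* : ∀ k x → preperiod ≤ x → x ∈ L ⇔ x + k * period ∈ L
  shift* zero    x q≤x = mk⇔ (subst L (sym (+-identityʳ x))) (subst L (+-identityʳ x))
  shift* (suc k) x q≤x = ⇔.trans (shift x q≤x)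
    (mk⇔ (subst L eq ∘ to rest) (from rest ∘ subst L (sym eq)))
    where
    rest = shift* k (x + period) (m≤n⇒m≤n+o period q≤x)
    eq = +-assoc x period (k * period)

  bound : ℕ
  bound = preperiod + period

  -- All multiples of d are needed because f b = f b′ + m * d with m unknown.
  reduce : ∀ b → ∃₂ λ b′ d → b′ < bound × b′ + d ≡ b ×
                 (∀ x m → b′ + x ∈ L ⇔ b′ + x + m * d ∈ L)
  reduce b with b <? preperiod
  ... | yes b<q = b , 0 , m≤n⇒m≤n+o period b<q , +-identityʳ b , λ x m →
          let eq = sym (trans (cong (λ y → b + x + y) (*-zeroʳ m)) (+-identityʳ (b + x)))
          in mk⇔ (subst L eq) (subst L (sym eq))
  -- Past the preperiod, the offset `y` is reduced modulo the period, so `d` is a multiple of the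
  -- period.
  ... | no  b≮q with y , refl ← m≤n⇒∃[o]m+o≡n (≮⇒≥ b≮q) =
          preperiod + y % period , y / period * period ,
          +-monoʳ-< preperiod (m%n<n y period) ,
          trans (+-assoc preperiod _ _) (cong (λ z → preperiod + z) (sym (m≡m%n+[m/n]*n y period))) ,
          λ x m → let z  = preperiod + y % period + x
                      eq = cong (λ w → z + w) (*-assoc m (y / period) period)
                      s  = shift* (m * (y / period)) z (m≤n⇒m≤n+o x (m≤m+n preperiod _))
                  in mk⇔ (subst L eq ∘ to s) (from s ∘ subst L (sym eq))

  -- The case `m = 1`: `b` and `b′` have the same residual `L - b`, so at most `bound` residuals are
  -- distinct.
  reduce₁ : ∀ b → ∃ λ b′ → b′ < bound × (∀ x → b′ + x ∈ L ⇔ b + x ∈ L)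
  reduce₁ b with b′ , d , b′<N , refl , equiv ← reduce b =
    b′ , b′<N , λ x → let eq = swap b′ d x in
      mk⇔ (subst L eq ∘ to (equiv x 1)) (from (equiv x 1) ∘ subst L (sym eq))
    where
    swap : ∀ b d x → b + x + 1 * d ≡ b + d + x
    swap = solve-∀

open UltimatelyPeriodic using (bound; reduce; reduce₁)

-- Regularity as decidable ultimate periodicity

regular⇒decidable : Regular L → Decidable L
regular⇒decidable (M , L⊆ , ⊆L) x = map′ ⊆L L⊆ (Subset._∈?_ _ _)

foldl-unary-+ : ∀ {A : Set} (g : A → ⊤ → A) s x y →
  foldl g s (unary (x + y)) ≡ foldl g (foldl g s (unary x)) (unary y)
foldl-unary-+ g s zero    y = refl
foldl-unary-+ g s (suc x) y = foldl-unary-+ g (g s tt) x y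

module _ (M : FiniteAutomaton ⊤) where
  open FiniteAutomaton M using (states; initial; step)

  state : ℕ → Fin states
  state x = foldl step initial (unary x)

  -- A run depends only on the state it starts from, so once a state recurs the runs from `i` and
  -- from `j` agree forever.
  state-shift : ∀ i j p → state i ≡ state j → i + p ≡ j →
    ∀ x → i ≤ x → state x ≡ state (x + p)
  state-shift i j p eq i+p≡j x i≤x with y , refl ← m≤n⇒∃[o]m+o≡n i≤x = begin
    state (i + y)                      ≡⟨ foldl-unary-+ step initial i y ⟩
    foldl step (state i) (unary y)     ≡⟨ cong (λ s → foldl step s (unary y)) eq ⟩
    foldl step (state j) (unary y)     ≡⟨ foldl-unary-+ step initial j y ⟨
    state (j + y)                      ≡⟨ cong (λ z → state (z + y)) i+p≡j ⟨
    state (i + p + y)                  ≡⟨ cong state (swap i p y) ⟩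
    state (i + y + p)                  ∎
    where
    open ≡-Reasoning
    swap : ∀ i p y → i + p + y ≡ i + y + p
    swap = solve-∀

regular⇒ultimatelyPeriodic : Regular L → UltimatelyPeriodic L
regular⇒ultimatelyPeriodic (M , L⊆ , ⊆L)
  -- The inputs 0, ..., `states` outnumber the states by one, so two of them reach the same state.
  with i , j , i<j , eq ← pigeonhole ≤-refl (state M ∘ toℕ)
  with p , i+p≡j ← m≤n⇒∃[o]m+o≡n (<⇒≤ i<j) = record
    { preperiod = toℕ i
    ; period    = p
    ; period≢0  = ≢-nonZero λ { refl → <⇒≢ i<j (trans (sym (+-identityʳ _)) i+p≡j) }
    ; shift     = λ x i≤x → let eq′ = state-shift M (toℕ i) (toℕ j) p eq i+p≡j x i≤x in
        mk⇔ (⊆L ∘ subst (Subset._∈ accepting) eq′ ∘ L⊆)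
            (⊆L ∘ subst (Subset._∈ accepting) (sym eq′) ∘ L⊆)
    }
  where open FiniteAutomaton M using (accepting)

-- The automaton has the representatives of reduce₁ as states.
ultimatelyPeriodic⇒regular : Decidable L → UltimatelyPeriodic L → Regular L
ultimatelyPeriodic⇒regular {L} L? periodic = M , L⊆ , ⊆L
  where
  N : ℕ
  N = bound periodic

  representative : ℕ → Fin N
  representative b = fromℕ< (proj₁ (proj₂ (reduce₁ periodic b)))

  representative-⇔ : ∀ b x → toℕ (representative b) + x ∈ L ⇔ b + x ∈ L
  representative-⇔ b x rewrite toℕ-fromℕ< (proj₁ (proj₂ (reduce₁ periodic b))) =
    proj₂ (proj₂ (reduce₁ periodic b)) x

  accepts : Fin N → Bool
  accepts s = does (L? (toℕ s))

  M : FiniteAutomaton ⊤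
  M = record
    { states    = N
    ; initial   = representative 0
    ; step      = λ s _ → representative (suc (toℕ s))
    ; accepting = tabulate accepts
    }

  open FiniteAutomaton M using (step; initial; accepting)

  -- Each step replaces a position by one with the same residual, so the letters still to be read
  -- have the same effect from either.
  run-⇔ : ∀ s x y → toℕ (foldl step s (unary x)) + y ∈ L ⇔ toℕ s + (x + y) ∈ L
  run-⇔ s zero    y = ⇔.refl
  run-⇔ s (suc x) y = ⇔.trans (run-⇔ (step s tt) x y)
    (⇔.trans (representative-⇔ (suc (toℕ s)) (x + y))
      (mk⇔ (subst L (sym (+-suc (toℕ s) (x + y)))) (subst L (+-suc (toℕ s) (x + y)))))

  state-⇔ : ∀ x → toℕ (state M x) ∈ L ⇔ x ∈ L
  state-⇔ x = mk⇔
    (subst L (+-identityʳ x) ∘ to run ∘ subst L (sym (+-identityʳ _)))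
    (subst L (+-identityʳ _) ∘ from run ∘ subst L (sym (+-identityʳ x)))
    where run = ⇔.trans (run-⇔ initial x 0) (representative-⇔ 0 (x + 0))

  L⊆ : ∀ {x} → x ∈ L → unary x ∈ Language M
  L⊆ {x} x∈L = lookup⇒[]= s accepting
    (trans (lookup∘tabulate accepts s) (dec-true (L? (toℕ s)) (from (state-⇔ x) x∈L)))
    where s = state M x

  ⊆L : ∀ {x} → unary x ∈ Language M → x ∈ L
  ⊆L {x} s∈ with s ← state M x in eq
    -- The second scrutinee equates the decision with `true`, which makes the case `no` absurd.
    with yes s∈L ← L? (toℕ s) | _ ← trans (sym (lookup∘tabulate accepts s)) ([]=⇒lookup s∈)
    = to (state-⇔ x) (subst (λ s → toℕ s ∈ L) (sym eq) s∈L)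

-- Closure under preimages

module _ {𝓛 : Family ℕ ℓ} (isLattice : IsLattice 𝓛) where
  open IsLattice isLattice

  -- A lattice need not contain the whole set, so the intersection starts from a member `B`.
  -- Decidability of `P` tells at each index whether to intersect once more.
  ⋂-closed : ∀ {B P : Pred ℕ 0ℓ} {F : ℕ → Pred ℕ 0ℓ} → Decidable P →
    B ∈ 𝓛 → (∀ i → F i ∈ 𝓛) →
    ∀ n → (λ x → x ∈ B × (∀ i → i < n → i ∈ P → x ∈ F i)) ∈ 𝓛
  ⋂-closed {B} P? B∈ F∈ zero = resp-≐ B _ ((λ x∈B → x∈B , λ _ ()) , proj₁) B∈
  ⋂-closed {P = P} {F} P? B∈ F∈ (suc n) with P? n
  ... | yes n∈P = resp-≐ _ _
        ( (λ { {x} ((x∈B , x∈F) , x∈Fn) → x∈B , λ i i<1+n i∈P →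
                 [ (λ i<n → x∈F i i<n i∈P) , (λ i≡n → subst (λ i → x ∈ F i) (sym i≡n) x∈Fn) ]′
                 (m<1+n⇒m<n∨m≡n i<1+n) })
        , (λ (x∈B , x∈F) → (x∈B , λ i i<n → x∈F i (m≤n⇒m≤1+n i<n)) , x∈F n ≤-refl n∈P))
        (∩-closed _ _ (⋂-closed P? B∈ F∈ n) (F∈ n))
  ... | no  n∉P = resp-≐ _ _
        ( (λ (x∈B , x∈F) → x∈B , λ i i<1+n i∈P →
             [ (λ i<n → x∈F i i<n i∈P) , (λ i≡n → contradiction (subst P i≡n i∈P) n∉P) ]′
             (m<1+n⇒m<n∨m≡n i<1+n))
        , (λ (x∈B , x∈F) → x∈B , λ i i<n → x∈F i (m≤n⇒m≤1+n i<n)))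
        (⋂-closed P? B∈ F∈ n)

  -- Dually, the empty set may be missing from the lattice, so the union starts from `B`.
  ⋃-closed : ∀ {B P : Pred ℕ 0ℓ} {F : ℕ → Pred ℕ 0ℓ} → Decidable P →
    B ∈ 𝓛 → (∀ i → F i ∈ 𝓛) →
    ∀ n → (B ∪ λ x → ∃ λ i → i < n × i ∈ P × x ∈ F i) ∈ 𝓛
  ⋃-closed {B} P? B∈ F∈ zero =
    resp-≐ B _ (inj₁ , [ id , (λ { (_ , () , _) }) ]′) B∈
  ⋃-closed {P = P} {F} P? B∈ F∈ (suc n) with P? n
  ... | yes n∈P = resp-≐ _ _
        ( (λ { (inj₁ (inj₁ x∈B)) → inj₁ x∈B
             ; (inj₁ (inj₂ (i , i<n , x∈))) → inj₂ (i , m≤n⇒m≤1+n i<n , x∈)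
             ; (inj₂ x∈Fn) → inj₂ (n , ≤-refl , n∈P , x∈Fn) })
        , (λ { (inj₁ x∈B) → inj₁ (inj₁ x∈B)
             ; {x} (inj₂ (i , i<1+n , i∈P , x∈F)) →
                 [ (λ i<n → inj₁ (inj₂ (i , i<n , i∈P , x∈F)))
                 , (λ i≡n → inj₂ (subst (λ i → x ∈ F i) i≡n x∈F)) ]′
                 (m<1+n⇒m<n∨m≡n i<1+n) }))
        (∪-closed _ _ (⋃-closed P? B∈ F∈ n) (F∈ n))
  ... | no  n∉P = resp-≐ _ _
        ( (λ { (inj₁ x∈B) → inj₁ x∈B
             ; (inj₂ (i , i<n , x∈)) → inj₂ (i , m≤n⇒m≤1+n i<n , x∈) })
        , (λ { (inj₁ x∈B) → inj₁ x∈B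
             ; (inj₂ (i , i<1+n , i∈P , x∈F)) →
                 [ (λ i<n → inj₂ (i , i<n , i∈P , x∈F))
                 , (λ i≡n → contradiction (subst P i≡n i∈P) n∉P) ]′
                 (m<1+n⇒m<n∨m≡n i<1+n) }))
        (⋃-closed P? B∈ F∈ n)

  decrement-closed : (∀ L → L ∈ 𝓛 → decrement 1 L ∈ 𝓛) →
    L ∈ 𝓛 → ∀ i → decrement i L ∈ 𝓛
  decrement-closed {L} dec L∈ zero =
    resp-≐ L _ ((λ {x} → subst L (sym (+-identityʳ x))) , (λ {x} → subst L (+-identityʳ x))) L∈
  decrement-closed {L} dec L∈ (suc i) =
    resp-≐ _ _ ((λ {x} → subst L (+-assoc x 1 i)) , (λ {x} → subst L (sym (+-assoc x 1 i))))
      (dec _ (decrement-closed dec L∈ i))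

-- One use of `up` at offset `i` lands on offset `d + i`, where it applies again; `k` uses add
-- `k * d`.
slide-up : ∀ c d → (∀ i → c + i ∈ L → c + d + i ∈ L) →
  ∀ k i → c + i ∈ L → c + i + k * d ∈ L
slide-up {L} c d up zero    i c+i∈L = subst L (sym (+-identityʳ _)) c+i∈L
slide-up {L} c d up (suc k) i c+i∈L =
  subst L (regroup c d i (k * d))
    (slide-up {L} c d up k (d + i) (subst L (+-assoc c d i) (up i c+i∈L)))
  where
  regroup : ∀ c d i z → c + (d + i) + z ≡ c + i + (d + z)
  regroup = solve-∀

slide-down : ∀ c d → (∀ i → c + d + i ∈ L → c + i ∈ L) →
  ∀ k i → c + i + k * d ∈ L → c + i ∈ L
slide-down {L} c d down zero    i = subst L (+-identityʳ _)
slide-down {L} c d down (suc k) i =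
  slide-down {L} c d down k i ∘ subst L (sym (+-assoc c i (k * d))) ∘
  down (i + k * d) ∘ subst L (regroup c d i (k * d))
  where
  regroup : ∀ c d i z → c + i + (d + z) ≡ c + d + (i + z)
  regroup = solve-∀

-- The hypothesis on `a` and `b` says that `b` lies in ⟨a⟩. The slide goes up if `a ≤ b` and down
-- otherwise. Extensiveness at the smaller of the two points writes its value as that point plus
-- some `i`.
preimage-transfer : (∀ a → f a ≥ a) → HasIntegralSlopes f →
  ∀ a b → (∀ i → a + i ∈ L → b + i ∈ L) → f a ∈ L → f b ∈ L
preimage-transfer {f} {L} f≥ slopes a b a⇒b fa∈L with ≤-total a b
... | inj₁ a≤b with d , refl ← m≤n⇒∃[o]m+o≡n a≤b
               with k , eq ← slopes a d
               with i , a+i≡fa ← m≤n⇒∃[o]m+o≡n (f≥ a) =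
      subst L (trans (cong (_+ k * d) a+i≡fa) (sym eq))
        (slide-up {L} a d a⇒b k i (subst L (sym a+i≡fa) fa∈L))
... | inj₂ b≤a with d , refl ← m≤n⇒∃[o]m+o≡n b≤a
               with k , eq ← slopes b d
               with i , b+i≡fb ← m≤n⇒∃[o]m+o≡n (f≥ b) =
      subst L b+i≡fb
        (slide-down {L} b d a⇒b k i
          (subst L (trans eq (cong (_+ k * d) (sym b+i≡fb))) fa∈L))

arithmetic⇒lattice : (∀ a → f a ≥ a) → HasIntegralSlopes f → LatticeCondition ℓ f
arithmetic⇒lattice {f} f≥ slopes 𝓛 isLattice regular dec L L∈ =
  resp-≐ _ _ (⊆f⁻¹L , f⁻¹L⊆)
    (⋃-closed isLattice (L? ∘ f)
      (⋂-closed isLattice {P = λ _ → ⊤} (λ _ → yes tt) L∈ L-i∈ N)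
      -- The starting member `L - (f a - a)` contains `a` as soon as `f a ∈ L`, so for such `a` it
      -- is itself one of the sets intersected in ⟨a⟩.
      (λ a → ⋂-closed isLattice (λ i → L? (a + i)) (L-i∈ (f a ∸ a)) L-i∈ N)
      N)
  where
  open IsLattice isLattice
  periodic = regular⇒ultimatelyPeriodic (regular L L∈)
  L?       = regular⇒decidable (regular L L∈)
  L-i∈     = decrement-closed isLattice dec L∈
  N        = bound periodic

  -- Every index has a representative below `N` with the same residual, so finitely many indices
  -- control them all, provided that `P` depends only on the residual.
  extend : ∀ b (P : Pred ℕ 0ℓ) → (∀ i i′ → (∀ x → i′ + x ∈ L ⇔ i + x ∈ L) → i ∈ P → i′ ∈ P) →
    (∀ i → i < N → i ∈ P → b + i ∈ L) → ∀ i → i ∈ P → b + i ∈ L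
  extend b P resp h i i∈P with i′ , i′<N , equiv ← reduce₁ periodic i =
    subst L (+-comm i b) (to (equiv b) (subst L (+-comm b i′) (h i′ i′<N (resp i i′ equiv i∈P))))

  ⋂[L-i] : Pred ℕ 0ℓ
  ⋂[L-i] x = x ∈ L × (∀ i → i < N → i ∈ (λ _ → ⊤) → x + i ∈ L)

  ⟨_⟩ : ℕ → Pred ℕ 0ℓ
  ⟨ a ⟩ x = x + (f a ∸ a) ∈ L × (∀ i → i < N → a + i ∈ L → x + i ∈ L)

  ⊆f⁻¹L : ∀ {b} → b ∈ (⋂[L-i] ∪ λ x → ∃ λ a → a < N × f a ∈ L × x ∈ ⟨ a ⟩) → f b ∈ L
  ⊆f⁻¹L {b} (inj₁ (_ , all)) =
    subst L (m+[n∸m]≡n (f≥ b)) (extend b (λ _ → ⊤) _ all (f b ∸ b) tt)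
  ⊆f⁻¹L {b} (inj₂ (a , _ , fa∈L , _ , a⇒b)) =
    preimage-transfer {f} {L} f≥ slopes a b
      (extend b (λ i → a + i ∈ L)
        (λ i i′ equiv → subst L (+-comm i′ a) ∘ from (equiv a) ∘ subst L (+-comm a i)) a⇒b)
      fa∈L

  f⁻¹L⊆ : ∀ {b} → f b ∈ L → b ∈ (⋂[L-i] ∪ λ x → ∃ λ a → a < N × f a ∈ L × x ∈ ⟨ a ⟩)
  f⁻¹L⊆ {b} fb∈L with a , d , a<N , refl , equiv ← reduce periodic b
                 with k , eq ← slopes a d =
    inj₂ (a , a<N , fa∈L , a⇒b _ (subst L (sym a+[fa∸a]≡fa) fa∈L) , λ i _ → a⇒b i)
    where
    a+[fa∸a]≡fa : a + (f a ∸ a) ≡ f a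
    a+[fa∸a]≡fa = m+[n∸m]≡n (f≥ a)

    fa∈L : f a ∈ L
    -- Since `f b = f a + k * d`, the slope `k` serves as the multiple `m` in the reduction of `b`
    -- to `a`.
    fa∈L = subst L a+[fa∸a]≡fa (from (equiv (f a ∸ a) k)
      (subst L (trans eq (cong (_+ k * d) (sym a+[fa∸a]≡fa))) fb∈L))

    swap : ∀ a i d → a + i + 1 * d ≡ a + d + i
    swap = solve-∀

    a⇒b : ∀ i → a + i ∈ L → a + d + i ∈ L
    a⇒b i = subst L (swap a i d) ∘ to (equiv i 1)

-- The two test lattices

-- Decidability is built into both test families because the automaton for a member needs it to mark
-- its accepting states.
Bounded : ℕ → Pred (Pred ℕ 0ℓ) 0ℓ
Bounded m L = Decidable L × (∀ x → x ∈ L → x ≤ m)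

Periodic : ℕ → Pred (Pred ℕ 0ℓ) 0ℓ
Periodic d L = Decidable L × (∀ x → x ∈ L ⇔ x + d ∈ L)

decidable-resp-≐ : ∀ {L L′ : Pred ℕ 0ℓ} → L ≐ L′ → Decidable L → Decidable L′
decidable-resp-≐ (L⊆ , ⊆L) L? x = map′ L⊆ ⊆L (L? x)

bounded-isLattice : ∀ m → IsLattice (λ L → Lift ℓ (Bounded m L))
bounded-isLattice m = record
  { resp-≐   = λ { _ _ eq (lift (L? , L≤)) →
                 lift (decidable-resp-≐ eq L? , λ x → L≤ x ∘ proj₂ eq) }
  ; nonEmpty = (_≤ m) , lift ((_≤? m) , λ _ → id)
  ; ∪-closed = λ { _ _ (lift (L? , L≤)) (lift (L′? , L′≤)) →
                 lift (L? ∪? L′? , λ x → [ L≤ x , L′≤ x ]′) }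
  ; ∩-closed = λ { _ _ (lift (L? , L≤)) (lift (L′? , _)) →
                 lift (L? ∩? L′? , λ x → L≤ x ∘ proj₁) }
  }

bounded⇒ultimatelyPeriodic : ∀ {m} → (∀ x → x ∈ L → x ≤ m) → UltimatelyPeriodic L
bounded⇒ultimatelyPeriodic {m = m} L≤ = record
  { preperiod = suc m
  ; period    = 1
  ; shift     = λ x m<x → mk⇔
      (λ x∈L → contradiction (L≤ x x∈L) (<⇒≱ m<x))
      (λ x+1∈L → contradiction (L≤ (x + 1) x+1∈L) (<⇒≱ (m≤n⇒m≤n+o 1 m<x)))
  }

periodic-isLattice : ∀ d → IsLattice (λ L → Lift ℓ (Periodic d L))
periodic-isLattice d = record
  { resp-≐   = λ { _ _ eq@(L⊆ , ⊆L) (lift (L? , s)) →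
                 lift (decidable-resp-≐ eq L? ,
                       λ x → mk⇔ (L⊆ ∘ to (s x) ∘ ⊆L) (L⊆ ∘ from (s x) ∘ ⊆L)) }
  ; nonEmpty = (λ _ → ⊤) , lift ((λ _ → yes tt) , λ _ → ⇔.refl)
  ; ∪-closed = λ { _ _ (lift (L? , s)) (lift (L′? , s′)) →
                 lift (L? ∪? L′? , λ x → mk⇔ (Sum.map (to (s x)) (to (s′ x)))
                                             (Sum.map (from (s x)) (from (s′ x)))) }
  ; ∩-closed = λ { _ _ (lift (L? , s)) (lift (L′? , s′)) →
                 lift (L? ∩? L′? , λ x → mk⇔ (Product.map (to (s x)) (to (s′ x)))
                                             (Product.map (from (s x)) (from (s′ x)))) }
  }

-- The preimage of {0, ..., `f a`} contains `a` and, being in the lattice, is itself bounded by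
-- `f a`.
lattice⇒extensive : LatticeCondition ℓ f → ∀ a → f a ≥ a
lattice⇒extensive {ℓ} {f} closed a = proj₂ (lower f⁻¹[≤fa]) a ≤-refl
  where
  f⁻¹[≤fa] : Lift ℓ (Bounded (f a) (f ⊢ (_≤ f a)))
  f⁻¹[≤fa] = closed (λ L → Lift ℓ (Bounded (f a) L)) (bounded-isLattice (f a))
    (λ { L (lift (L? , L≤)) → ultimatelyPeriodic⇒regular L? (bounded⇒ultimatelyPeriodic L≤) })
    (λ { L (lift (L? , L≤)) → lift ((λ x → L? (x + 1)) ,
           λ x x+1∈L → ≤-trans (m≤m+n x 1) (L≤ (x + 1) x+1∈L)) })
    (_≤ f a) (lift ((_≤? f a) , λ _ → id))

-- The residue class of `f a` modulo `d` is `d`-periodic, hence so is its preimage. The preimage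
-- contains `a`, so it contains `a + d`; monotonicity makes the slope natural.
lattice⇒integralSlopes : NonDecreasing f → LatticeCondition ℓ f → HasIntegralSlopes f
lattice⇒integralSlopes {f} mono closed a zero =
  0 , trans (cong f (+-identityʳ a)) (sym (+-identityʳ (f a)))
lattice⇒integralSlopes {f} {ℓ} mono closed a d@(suc _) =
  %≡%⇒∃k (f a) (f (a + d)) d (mono (m≤m+n a d)) (to (proj₂ (lower f⁻¹[≡fa]) a) refl)
  where
  ≡fa[mod-d] : Pred ℕ 0ℓ
  ≡fa[mod-d] x = x % d ≡ f a % d

  f⁻¹[≡fa] : Lift ℓ (Periodic d (f ⊢ ≡fa[mod-d]))
  f⁻¹[≡fa] = closed (λ L → Lift ℓ (Periodic d L)) (periodic-isLattice d)
    (λ { L (lift (L? , s)) → ultimatelyPeriodic⇒regular L?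
           (record { preperiod = 0 ; period = d ; shift = λ x _ → s x }) })
    (λ { L (lift (L? , s)) → lift ((λ x → L? (x + 1)) , λ x →
           let eq = swap x d in
           mk⇔ (subst L eq ∘ to (s (x + 1))) (from (s (x + 1)) ∘ subst L (sym eq))) })
    ≡fa[mod-d]
    (lift ((λ x → x % d ≟ f a % d) , λ x →
      mk⇔ (trans ([m+n]%n≡m%n x d)) (trans (sym ([m+n]%n≡m%n x d)))))
    where
    swap : ∀ x d → x + 1 + d ≡ x + d + 1
    swap = solve-∀

-- The two examples and the equivalence

integralSlopes⇒isExample : NonDecreasing f → (∀ a → f a ≥ a) → HasIntegralSlopes f → IsExample ℓ f
integralSlopes⇒isExample mono f≥ slopes =
  mono , arithmetic⇒lattice f≥ slopes , f≥ , integralSlopes⇒congruence slopes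

m≤m^n : ∀ m n .{{_ : NonZero n}} → m ≤ m ^ n
m≤m^n zero      n       = z≤n
m≤m^n m@(suc _) (suc n) = m≤m*n m (m ^ n) {{m^n≢0 m n}}

theorem1p1 : (ℓ : Level) →
    ((f : ℕ → ℕ) → NonDecreasing f →
    LatticeCondition ℓ f ⇔ ArithmeticCondition f)
    ×
    ((n : ℕ) → n ≥ 1 →
    (IsExample ℓ (λ x → n * x) × (∀ L → ((λ x → n * x) ⊢ L) ≐ quotient n L))
    ×
    (IsExample ℓ (λ x → x ^ n) × (∀ L → ((λ x → x ^ n) ⊢ L) ≐ root n L)))
theorem1p1 ℓ =
  (λ f mono → mk⇔
    (λ closed → lattice⇒extensive closed ,
                integralSlopes⇒congruence (lattice⇒integralSlopes mono closed))
    (λ (f≥ , congr) → arithmetic⇒lattice f≥ (congruence⇒integralSlopes mono congr))) ,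
  -- Matching on `suc` supplies `NonZero n`, needed for extensiveness: for `n = 0` both maps are
  -- constant.
  λ { n@(suc _) _ →
    (integralSlopes⇒isExample (*-monoʳ-≤ n) (λ a → m≤n*m a n) (*-integralSlopes n) , λ _ → id , id) ,
    (integralSlopes⇒isExample (^-monoˡ-≤ n) (λ a → m≤m^n a n) (^-integralSlopes n) , λ _ → id , id) }
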